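{- Let $\mathcal T$ be a péijí topology on $\mathbb Z$ with maximal family $\{\mathcal T_n\}_{n\in\mathbb N_1}$, and assume that $\mathcal T$ has a determining monoid $\mathcal M\subseteq\mathbb N_1$ such that $\pi_n^m(B_m)=B_n$ for all $n,m\in\mathcal M$ with $n$ dividing $m$. Let $$B:=\bigcap_{n\in\mathcal M}\hat\pi_n^{ -1}(B_n)\subseteq\hat{\mathbb Z}\,.$$ Then every $x\in B$ is an indiscrete point of $(\hat{\mathbb Z},\mathcal T)$, that is, the only open subset of $(\hat{\mathbb Z},\mathcal T)$ containing $x$ is $\hat{\mathbb Z}$ itself.
   Context: Notation: $\mathbb N_1$ is the set of positive integers; $\pi_n\colon\mathbb Z\to\mathbb Z/n\mathbb Z$ is reduction modulo $n$; if $n\mid m$, $\pi_n^m\colon\mathbb Z/m\mathbb Z\to\mathbb Z/n\mathbb Z$ is the natural projection. $\hat{\mathbb Z}=\varprojlim_n\mathbb Z/n\mathbb Z$, seen as the subset of compatible sequences in $\prod_{n\in\mathbb N_1}\mathbb Z/n\mathbb Z$, and $\hat\pi_n\colon\hat{\mathbb Z}\to\mathbb Z/n\mathbb Z$ is the $n$-th projection. Péijí topologies: a family $\{\mathcal T_n\}_{n\in\mathbb N_1}$ of topologies, $\mathcal T_n$ on $\mathbb Z/n\mathbb Z$, induces the coarsest topology $\mathcal T$ on $\mathbb Z$ such that all maps $\pi_n\colon(\mathbb Z,\mathcal T)\to(\mathbb Z/n\mathbb Z,\mathcal T_n)$ are continuous. A péijí topology is a topology on $\mathbb Z$ obtained in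 this way. Two families are equivalent if they induce the same topology on $\mathbb Z$; a family is maximal if each $\mathcal T_n$ is the finest possible among all families in its equivalence class. The maximal family of $\mathcal T$ consists of the quotient topologies: $A\subseteq\mathbb Z/n\mathbb Z$ is in $\mathcal T_n$ iff $\pi_n^{ -1}(A)\in\mathcal T$. Determining monoid: a multiplicative submonoid $\mathcal M\subseteq\mathbb N_1$ such that the maximal family $\{\mathcal T_n\}$ of $\mathcal T$ is equivalent to the family $\{\mathcal T'_n\}$ with $\mathcal T_n'=\mathcal T_n$ for $n\in\mathcal M$ and $\mathcal T_n'$ the trivial topology otherwise. $B_n$ denotes the intersection of all nonempty closed subsets of $(\mathbb Z/n\mathbb Z,\mathcal T_n)$, with $\{\mathcal T_n\}$ the maximal family. $(\hat{\mathbb Z},\mathcal T)$ denotes $\hat{\mathbb Z}$ with the subspace topology from the product space $\prod_{n\in\mathbb N_1}(\mathbb Z/n\mathbb Z,\mathcal T_n)$, with $\{\mathcal T_n\}$ the maximal family. -}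

module Defs where

open import Data.Empty using (⊥-elim)
open import Data.Fin.Base using (Fin; toℕ; fromℕ<)
open import Data.Fin.Subset as Sub using (Subset; Nonempty; ∁)
open import Data.Fin.Subset.Properties
  using (∩-identityˡ; ∩-identityʳ; ∩-zeroˡ; ∩-zeroʳ;
         ∪-identityˡ; ∪-identityʳ; ∪-zeroˡ; ∪-zeroʳ)
open import Data.Integer.Base using (ℤ; +_; _%ℕ_)
open import Data.Integer.DivMod using (n%ℕd<d)
open import Data.Nat.Base as ℕ using (ℕ; NonZero)
open import Data.Nat.Divisibility.Core using (_∣_)
open import Data.Nat.Properties using (m*n≢0)
open import Data.Product.Base using (Σ-syntax; ∃-syntax; _×_; _,_; proj₁; proj₂)
open import Data.Sum.Base using (_⊎_; inj₁; inj₂)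
open import Function.Bundles using (_⇔_)
open import Level using (0ℓ) renaming (suc to lsuc)
open import Relation.Binary.PropositionalEquality using (_≡_; sym; subst)
open import Relation.Unary using (Pred; _∈_; _∉_; _⊆_; _≐_; _∩_; _⊢_; U; ⋃)

------------------------------------------------------------------------
-- Positive integers, residues and profinite integers

record ℕ₁ : Set where
  constructor pos
  field
    value         : ℕ
    .{{nonZero}}  : NonZero value

open ℕ₁ using (value) public

1₁ : ℕ₁
1₁ = pos 1

infixl 7 _*₁_
_*₁_ : ℕ₁ → ℕ₁ → ℕ₁
pos m {{p}} *₁ pos n {{q}} = pos (m ℕ.* n) {{m*n≢0 m n {{p}} {{q}}}}

infix 4 _∣₁_
_∣₁_ : ℕ₁ → ℕ₁ → Set
n ∣₁ m = value n ∣ value m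

-- A residue class is represented by its least nonnegative element.
ℤ/_ : ℕ₁ → Set
ℤ/ n = Fin (value n)

π : (n : ℕ₁) → ℤ → ℤ/ n
π (pos n {{p}}) z = fromℕ< (n%ℕd<d z n {{p}})

π↓ : (n m : ℕ₁) → n ∣₁ m → ℤ/ m → ℤ/ n
π↓ n m _ a = π n (+ toℕ a)

Compatible : Pred ((n : ℕ₁) → ℤ/ n) 0ℓ
Compatible s = ∀ n m (n∣m : n ∣₁ m) → π↓ n m n∣m (s m) ≡ s n

Ẑ : Set
Ẑ = Σ[ s ∈ ((n : ℕ₁) → ℤ/ n) ] Compatible s

π̂ : (n : ℕ₁) → Ẑ → ℤ/ n
π̂ n x = proj₁ x n

------------------------------------------------------------------------
-- Topologies

-- `open-≐` is needed because extensionally equal predicates need not be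
-- propositionally equal.  Small index sets suffice in `open-⋃`: if every point
-- of V has an open neighbourhood inside V, then V is a union of open sets
-- indexed by the points of V.
record Topology (X : Set) : Set₂ where
  field
    Open   : Pred (Pred X 0ℓ) (lsuc 0ℓ)
    open-≐ : ∀ {V W} → V ≐ W → Open V → Open W
    open-U : Open U
    open-∩ : ∀ {V W} → Open V → Open W → Open (V ∩ W)
    open-⋃ : ∀ {I : Set} {V : I → Pred X 0ℓ} →
             (∀ i → Open (V i)) → Open (⋃ I V)

-- Topologies on the finite set Fin n, whose subsets are taken to be the decidable
-- ones, `Subset n` (classically, all of them).  As there are finitely many,
-- closure under arbitrary unions is closure under the empty and binary ones.
record FinTopology (n : ℕ) : Set₂ where
  field
    Open   : Pred (Subset n) (lsuc 0ℓ)
    open-⊥ : Open Sub.⊥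
    open-⊤ : Open Sub.⊤
    open-∩ : ∀ {A B} → Open A → Open B → Open (A Sub.∩ B)
    open-∪ : ∀ {A B} → Open A → Open B → Open (A Sub.∪ B)

  Closed : Pred (Subset n) (lsuc 0ℓ)
  Closed C = Open (∁ C)

open Topology using (Open) public
open FinTopology using (Closed) renaming (Open to OpenF) public

infix 4 _≈ᵀ_
_≈ᵀ_ : ∀ {X} → Topology X → Topology X → Set₁
S ≈ᵀ T = ∀ V → Open S V ⇔ Open T V

-- The coarsest topology containing 𝒮 (see `generated-least`).
data Generated {X : Set} (𝒮 : Pred (Pred X 0ℓ) (lsuc 0ℓ)) :
               Pred (Pred X 0ℓ) (lsuc 0ℓ) where
  basic : ∀ {V} → V ∈ 𝒮 → Generated 𝒮 V
  resp  : ∀ {V W} → V ≐ W → Generated 𝒮 V → Generated 𝒮 W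
  whole : Generated 𝒮 U
  inter : ∀ {V W} → Generated 𝒮 V → Generated 𝒮 W → Generated 𝒮 (V ∩ W)
  union : ∀ {I : Set} {V : I → Pred X 0ℓ} →
          (∀ i → Generated 𝒮 (V i)) → Generated 𝒮 (⋃ I V)

generated : ∀ {X} → Pred (Pred X 0ℓ) (lsuc 0ℓ) → Topology X
generated 𝒮 = record
  { Open   = Generated 𝒮
  ; open-≐ = resp
  ; open-U = whole
  ; open-∩ = inter
  ; open-⋃ = union
  }

generated-least : ∀ {X} {𝒮 : Pred (Pred X 0ℓ) (lsuc 0ℓ)} (T : Topology X) →
                  𝒮 ⊆ Open T → Open (generated 𝒮) ⊆ Open T
generated-least T 𝒮⊆T (basic V∈𝒮) = 𝒮⊆T V∈𝒮
generated-least T 𝒮⊆T (resp e V)  = Topology.open-≐ T e (generated-least T 𝒮⊆T V)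
generated-least T 𝒮⊆T whole       = Topology.open-U T
generated-least T 𝒮⊆T (inter V W) =
  Topology.open-∩ T (generated-least T 𝒮⊆T V) (generated-least T 𝒮⊆T W)
generated-least T 𝒮⊆T (union V)   =
  Topology.open-⋃ T (λ i → generated-least T 𝒮⊆T (V i))

-- The coarsest topology on X making all the maps f i continuous.
initial : ∀ {X I : Set} {k : I → ℕ} →
          (∀ i → FinTopology (k i)) → (∀ i → X → Fin (k i)) → Topology X
initial 𝒯 f = generated λ V →
  ∃[ i ] ∃[ A ] OpenF (𝒯 i) A × V ≐ (f i ⊢ (Sub._∈ A))

subspace : ∀ {X} → Topology X → (P : Pred X 0ℓ) → Topology (Σ[ x ∈ X ] P x)
subspace T P = record
  { Open   = λ V → ∃[ W ] Open T W × V ≐ (proj₁ ⊢ W)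
  ; open-≐ = λ { (V⊆V′ , V′⊆V) (W , oW , V⊆W , W⊆V) →
                 W , oW , (λ v → V⊆W (V′⊆V v)) , (λ w → V⊆V′ (W⊆V w)) }
  ; open-U = U , open-U , (λ u → u) , (λ u → u)
  ; open-∩ = λ { (W , oW , V⊆W , W⊆V) (W′ , oW′ , V′⊆W′ , W′⊆V′) →
                 W ∩ W′ , open-∩ oW oW′ ,
                 (λ { (v , v′) → V⊆W v , V′⊆W′ v′ }) ,
                 (λ { (w , w′) → W⊆V w , W′⊆V′ w′ }) }
  ; open-⋃ = λ {I} o →
                 ⋃ I (λ i → proj₁ (o i)) , open-⋃ (λ i → proj₁ (proj₂ (o i))) ,
                 (λ { (i , v) → i , proj₁ (proj₂ (proj₂ (o i))) v }) ,
                 (λ { (i , w) → i , proj₂ (proj₂ (proj₂ (o i))) w })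
  }
  where open Topology T using (open-U; open-∩; open-⋃)

IsIndiscretePoint : ∀ {X} → Topology X → X → Set₁
IsIndiscretePoint T x = ∀ V → Open T V → x ∈ V → V ≐ U

------------------------------------------------------------------------
-- Péijí topologies

Family : Set₂
Family = (n : ℕ₁) → FinTopology (value n)

induced : Family → Topology ℤ
induced 𝒯 = initial 𝒯 π

IsPéijí : Topology ℤ → Set₂
IsPéijí T = Σ[ 𝒯 ∈ Family ] induced 𝒯 ≈ᵀ T

Equivalent : Family → Family → Set₁
Equivalent 𝒮 𝒯 = induced 𝒮 ≈ᵀ induced 𝒯

IsMaximal : Family → Set₂
IsMaximal 𝒯 = ∀ (𝒮 : Family) → Equivalent 𝒮 𝒯 → ∀ n → OpenF (𝒮 n) ⊆ OpenF (𝒯 n)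

IsMaximalFamilyOf : Topology ℤ → Family → Set₂
IsMaximalFamilyOf T 𝒯 = (induced 𝒯 ≈ᵀ T) × IsMaximal 𝒯

data IsTrivial {n : ℕ} : Pred (Subset n) (lsuc 0ℓ) where
  empty : IsTrivial Sub.⊥
  full  : IsTrivial Sub.⊤

-- The family equal to 𝒯 n for n ∈ M and to the trivial topology otherwise.
-- Since ∅ and the whole space are open in 𝒯 n anyway, the sum below avoids
-- deciding membership in M; see `restrict-∈` and `restrict-∉`.
restrict : Pred ℕ₁ 0ℓ → Family → Family
restrict M 𝒯 n = record
  { Open   = RestrictedOpen
  ; open-⊥ = inj₂ empty
  ; open-⊤ = inj₂ full
  ; open-∩ = inter′
  ; open-∪ = union′
  }
  where
  open FinTopology (𝒯 n) using (open-∩; open-∪)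

  RestrictedOpen : Pred (Subset (value n)) (lsuc 0ℓ)
  RestrictedOpen A = (n ∈ M × OpenF (𝒯 n) A) ⊎ IsTrivial A

  inter′ : ∀ {A B} → RestrictedOpen A → RestrictedOpen B →
           RestrictedOpen (A Sub.∩ B)
  inter′ (inj₁ (m , a)) (inj₁ (_ , b)) = inj₁ (m , open-∩ a b)
  inter′ {B = B} (inj₂ empty) _ = subst RestrictedOpen (sym (∩-zeroˡ B)) (inj₂ empty)
  inter′ {B = B} (inj₂ full)  b = subst RestrictedOpen (sym (∩-identityˡ B)) b
  inter′ {A = A} (inj₁ _) (inj₂ empty) = subst RestrictedOpen (sym (∩-zeroʳ A)) (inj₂ empty)
  inter′ {A = A} (inj₁ a) (inj₂ full)  = subst RestrictedOpen (sym (∩-identityʳ A)) (inj₁ a)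

  union′ : ∀ {A B} → RestrictedOpen A → RestrictedOpen B →
           RestrictedOpen (A Sub.∪ B)
  union′ (inj₁ (m , a)) (inj₁ (_ , b)) = inj₁ (m , open-∪ a b)
  union′ {B = B} (inj₂ empty) b = subst RestrictedOpen (sym (∪-identityˡ B)) b
  union′ {B = B} (inj₂ full)  _ = subst RestrictedOpen (sym (∪-zeroˡ B)) (inj₂ full)
  union′ {A = A} (inj₁ a) (inj₂ empty) = subst RestrictedOpen (sym (∪-identityʳ A)) (inj₁ a)
  union′ {A = A} (inj₁ _) (inj₂ full)  = subst RestrictedOpen (sym (∪-zeroʳ A)) (inj₂ full)

restrict-∈ : ∀ M 𝒯 n → n ∈ M → OpenF (restrict M 𝒯 n) ≐ OpenF (𝒯 n)
restrict-∈ M 𝒯 n n∈M = to , (λ a → inj₁ (n∈M , a))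
  where
  to : OpenF (restrict M 𝒯 n) ⊆ OpenF (𝒯 n)
  to (inj₁ (_ , a)) = a
  to (inj₂ empty)   = FinTopology.open-⊥ (𝒯 n)
  to (inj₂ full)    = FinTopology.open-⊤ (𝒯 n)

restrict-∉ : ∀ M 𝒯 n → n ∉ M → OpenF (restrict M 𝒯 n) ≐ IsTrivial
restrict-∉ M 𝒯 n n∉M = to , inj₂
  where
  to : OpenF (restrict M 𝒯 n) ⊆ IsTrivial
  to (inj₁ (n∈M , _)) = ⊥-elim (n∉M n∈M)
  to (inj₂ t)         = t

-- M is a determining monoid of the topology whose maximal family is 𝒯.
record IsDeterminingMonoid (𝒯 : Family) (M : Pred ℕ₁ 0ℓ) : Set₁ where
  field
    1∈M         : 1₁ ∈ M
    *-closed    : ∀ {m n} → m ∈ M → n ∈ M → m *₁ n ∈ M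
    determining : Equivalent 𝒯 (restrict M 𝒯)

closedCore : ∀ {n} → FinTopology n → Pred (Fin n) (lsuc 0ℓ)
closedCore T a = ∀ C → Closed T C → Nonempty C → a Sub.∈ C

image : ∀ {ℓ} {X Y : Set} → (X → Y) → Pred X ℓ → Pred Y ℓ
image f P y = ∃[ x ] x ∈ P × f x ≡ y

profinite : Family → Topology Ẑ
profinite 𝒯 = subspace (initial 𝒯 (λ n s → s n)) Compatible

profiniteB : Family → Pred ℕ₁ 0ℓ → Pred Ẑ (lsuc 0ℓ)
profiniteB 𝒯 M x = ∀ n → n ∈ M → π̂ n x ∈ closedCore (𝒯 n)

{-# OPTIONS --safe #-}

-- A point x of B has no proper open neighbourhood in any coordinate.  For n ∈ M
-- this is the definition of B_n.  For arbitrary n, let A ∋ π̂ₙ x be open in ℤ/n.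
-- As M is determining, O = πₙ⁻¹(A) contains with each of its points a residue
-- class modulo some element of M.  O is n-periodic, so finitely many of its points
-- represent all of it, and O is m-periodic for the product m ∈ M of their moduli.
-- By maximality the image of O is open in ℤ/m; it contains π̂ₘ x, so it is all of
-- ℤ/m by the first case, whence O = ℤ and A = ℤ/n.
module Submission where

open import Defs
open import Algebra.Lattice.Properties.BooleanAlgebra using (¬-involutive)
open import Data.Bool.Base using (Bool; true; false)
open import Data.Empty using (⊥; ⊥-elim)
open import Data.Fin.Base using (Fin; zero; suc; toℕ)
open import Data.Fin.Properties using (toℕ<n; toℕ-injective; toℕ-fromℕ<)
open import Data.Fin.Subset as Sub using (Subset; ∁)
open import Data.Fin.Subset.Properties
  using (_∈?_; ∈⊤; ∉⊥; x∈p∩q⁺; x∈p∩q⁻; x∈p∪q⁺; x∈p∪q⁻; x∉p⇒x∈∁p; x∈∁p⇒x∉p;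
         ∪-∩-booleanAlgebra)
open import Data.Integer.Base using (ℤ; +_; _+_; _-_; -_; _*_; _%ℕ_; _/ℕ_; _⊖_; ∣_∣)
open import Data.Integer.Divisibility.Signed
  using (_∣_; divides; ∣⇒∣ᵤ; ∣ᵤ⇒∣; ∣-trans; ∣m⇒∣-m; ∣m∣n⇒∣m+n)
open import Data.Integer.DivMod using (n%ℕd<d; a≡a%ℕn+[a/ℕn]*n)
open import Data.Integer.Properties
  using (m-n≡m⊖n; ∣m⊝n∣≤m⊔n; ∣i∣≡0⇒i≡0; i-j≡0⇒i≡j; +-injective)
open import Data.Integer.Tactic.RingSolver using (solve-∀)
open import Data.Nat.Base as ℕ using (ℕ; _<_)
import Data.Nat.Divisibility as ℕ
import Data.Nat.Properties as ℕ
open import Data.Product.Base using (∃-syntax; _×_; _,_; proj₁; proj₂)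
open import Data.Sum.Base using (inj₁; inj₂)
open import Data.Vec.Base using (lookup; tabulate)
open import Data.Vec.Properties using (lookup∘tabulate; lookup⇒[]=; []=⇒lookup)
open import Function.Base using (_∘_)
open import Function.Bundles using (Equivalence; mk⇔)
open import Level using (Level; 0ℓ)
open import Relation.Binary.PropositionalEquality
  using (_≡_; sym; trans; cong; subst; module ≡-Reasoning)
open import Relation.Nullary using (yes; no; contradiction)
open import Relation.Unary using (Pred; _∈_; _≐_; _∪_; _⊢_; ⋃)
open import Relation.Unary.Properties using (≐-refl)

private
  variable
    ℓ : Level
    k l : ℕ
    m n : ℕ₁
    w y z : ℤ

-- Congruences and residue classes

∣-*₁ˡ : ∀ m n → m ∣₁ (m *₁ n)
∣-*₁ˡ (pos m) (pos n) = ℕ.m∣m*n n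

∣-*₁ʳ : ∀ m n → n ∣₁ (m *₁ n)
∣-*₁ʳ (pos m) (pos n) = ℕ.n∣m*n m

infix 4 _≡_mod_
-- A record rather than a synonym, so that `y`, `z` and `n` can be inferred from the type; a bare
-- divisibility of `y - z` would not determine them.
record _≡_mod_ (y z : ℤ) (n : ℕ₁) : Set where
  constructor ∣-diff
  field n∣y-z : + value n ∣ y - z

mod-sym : y ≡ z mod n → z ≡ y mod n
mod-sym {y} {z} (∣-diff p) = ∣-diff (subst (_ ∣_) (eq y z) (∣m⇒∣-m p))
  where
  eq : ∀ y z → - (y - z) ≡ z - y
  eq = solve-∀

mod-trans : w ≡ y mod n → y ≡ z mod n → w ≡ z mod n
mod-trans {w} {y} {n} {z} (∣-diff p) (∣-diff q) =
  ∣-diff (subst (_ ∣_) (eq w y z) (∣m∣n⇒∣m+n p q))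
  where
  eq : ∀ w y z → (w - y) + (y - z) ≡ w - z
  eq = solve-∀

mod-∣ : m ∣₁ n → y ≡ z mod n → y ≡ z mod m
mod-∣ m∣n (∣-diff p) = ∣-diff (∣-trans (∣ᵤ⇒∣ m∣n) p)

toℕ-π-mod : ∀ z (n : ℕ₁) → (+ toℕ (π n z)) ≡ z mod n
toℕ-π-mod z n@(pos d) = mod-sym (∣-diff (divides (z /ℕ d) eq))
  where
  cancel : ∀ a b → a + b - a ≡ b
  cancel = solve-∀

  eq : z - + toℕ (π n z) ≡ (z /ℕ d) * + d
  eq = begin
    z - + toℕ (π n z)                                ≡⟨ cong (λ r → z - + r) (toℕ-fromℕ< (n%ℕd<d z d)) ⟩
    z - + (z %ℕ d)                                   ≡⟨ cong (_- + (z %ℕ d)) (a≡a%ℕn+[a/ℕn]*n z d) ⟩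
    + (z %ℕ d) + (z /ℕ d) * + d - + (z %ℕ d)         ≡⟨ cancel (+ (z %ℕ d)) _ ⟩
    (z /ℕ d) * + d                                   ∎
    where open ≡-Reasoning

-- The distance between `r` and `s` is at most their maximum, hence below the modulus, and a
-- multiple of the modulus that small is 0.
remainder-unique : ∀ {r s} → r < value n → s < value n → (+ r) ≡ (+ s) mod n → r ≡ s
remainder-unique {pos d} {r} {s} r<d s<d (∣-diff d∣r-s) with ∣ r ⊖ s ∣ in eq
... | ℕ.zero = +-injective (i-j≡0⇒i≡j (+ r) (+ s) (trans (m-n≡m⊖n r s) (∣i∣≡0⇒i≡0 eq)))
... | ℕ.suc t = contradiction
  (subst (d ℕ.∣_) (trans (cong ∣_∣ (m-n≡m⊖n r s)) eq) (∣⇒∣ᵤ d∣r-s))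
  (ℕ.>⇒∤ (subst (_< d) eq (ℕ.≤-<-trans (∣m⊝n∣≤m⊔n r s) (ℕ.⊔-lub r<d s<d))))

mod⇒≡ : ∀ n {a b : ℤ/ n} → (+ toℕ a) ≡ (+ toℕ b) mod n → a ≡ b
mod⇒≡ _ {a} {b} = toℕ-injective ∘ remainder-unique (toℕ<n a) (toℕ<n b)

mod⇒π≡ : ∀ n → y ≡ z mod n → π n y ≡ π n z
mod⇒π≡ {y} {z} n y≡z =
  mod⇒≡ n (mod-trans (toℕ-π-mod y n) (mod-trans y≡z (mod-sym (toℕ-π-mod z n))))

π-toℕ : ∀ n (a : ℤ/ n) → π n (+ toℕ a) ≡ a
π-toℕ n a = mod⇒≡ n (toℕ-π-mod (+ toℕ a) n)

-- Preimages of decidable subsets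

preimage : (Fin k → Fin l) → Subset l → Subset k
preimage f A = tabulate (lookup A ∘ f)

∈-preimage⁺ : ∀ {f : Fin k → Fin l} {A i} → f i Sub.∈ A → i Sub.∈ preimage f A
∈-preimage⁺ {f = f} {A} {i} fi∈A =
  lookup⇒[]= i _ (trans (lookup∘tabulate (lookup A ∘ f) i) ([]=⇒lookup fi∈A))

∈-preimage⁻ : ∀ {f : Fin k → Fin l} {A i} → i Sub.∈ preimage f A → f i Sub.∈ A
∈-preimage⁻ {f = f} {A} {i} i∈ =
  lookup⇒[]= (f i) A (trans (sym (lookup∘tabulate (lookup A ∘ f) i)) ([]=⇒lookup i∈))

-- Quotient topologies and maximal families

module _ {X : Set} (T : Topology X) where
  open Topology T using (open-≐; open-⋃)

  open-∅ : Open T (λ _ → ⊥)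
  open-∅ = open-≐ {V = ⋃ ⊥ (λ ())} ((λ { (() , _) }) , ⊥-elim) (open-⋃ (λ ()))

  open-∪₂ : ∀ {V W} → Open T V → Open T W → Open T (V ∪ W)
  open-∪₂ {V} {W} oV oW = open-≐ {V = ⋃ Bool pick}
    ((λ { (true , v) → inj₁ v ; (false , w) → inj₂ w }) ,
     (λ { (inj₁ v) → true , v ; (inj₂ w) → false , w }))
    (open-⋃ (λ { true → oV ; false → oW }))
    where
    pick : Bool → Pred X 0ℓ
    pick true  = V
    pick false = W

  quotient : (X → Fin k) → FinTopology k
  quotient f = record
    { Open   = λ A → Open T (f ⊢ (Sub._∈ A))
    ; open-⊥ = open-≐ ((λ ()) , ∉⊥) open-∅
    ; open-⊤ = open-≐ ((λ _ → ∈⊤) , _) (Topology.open-U T)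
    ; open-∩ = λ {A} {B} a b →
        open-≐ (x∈p∩q⁺ , x∈p∩q⁻ A B) (Topology.open-∩ T a b)
    ; open-∪ = λ {A} {B} a b →
        open-≐ (x∈p∪q⁺ , x∈p∪q⁻ A B) (open-∪₂ a b)
    }

-- The quotient family `𝒬` induces the same topology: its subbasic sets are open by construction,
-- and every subbasic set of `𝒯` is also one of `𝒬`. Maximality then makes `𝒯 n` at least as fine as
-- `𝒬 n`.
maximal⇒quotient : ∀ 𝒯 → IsMaximal 𝒯 → ∀ n {A} →
                   Open (induced 𝒯) (π n ⊢ (Sub._∈ A)) → OpenF (𝒯 n) A
maximal⇒quotient 𝒯 maximal = maximal 𝒬 𝒬≈𝒯
  where
  𝒬 : Family
  𝒬 n = quotient (induced 𝒯) (π n)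

  𝒬≈𝒯 : Equivalent 𝒬 𝒯
  𝒬≈𝒯 V = mk⇔
    (generated-least (induced 𝒯) λ { (n , A , oA , V⊆ , ⊆V) → resp (⊆V , V⊆) oA })
    (generated-least (induced 𝒬) λ { (n , A , oA , V≐) →
      basic (n , A , basic (n , A , oA , ≐-refl) , V≐) })

-- Points without proper open neighbourhoods

-- If `A` missed a point, its complement would be closed and nonempty and so contain `a`.
open-closedCore⇒full : (T : FinTopology k) → ∀ {A a} → a ∈ closedCore T →
                       OpenF T A → a Sub.∈ A → ∀ b → b Sub.∈ A
open-closedCore⇒full T {A} a∈core oA a∈A b with b ∈? A
... | yes b∈A = b∈A
... | no  b∉A = contradiction a∈A
  (x∈∁p⇒x∉p (a∈core (∁ A) closed (b , x∉p⇒x∈∁p b∉A)))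
  where
  closed : Closed T (∁ A)
  closed = subst (OpenF T) (sym (¬-involutive (∪-∩-booleanAlgebra _) A)) oA

-- Induction on the generation of `W`: indiscreteness at `x` passes from subbasic sets to all open
-- sets. In a union, a single member containing `x` is already everything.
initial-full : ∀ {X I : Set} {κ : I → ℕ}
               (𝒯 : ∀ i → FinTopology (κ i)) (f : ∀ i → X → Fin (κ i)) {x} →
               (∀ i {A} → OpenF (𝒯 i) A → f i x Sub.∈ A → ∀ b → b Sub.∈ A) →
               ∀ {W} → Open (initial 𝒯 f) W → x ∈ W → ∀ y → y ∈ W
initial-full 𝒯 f A-full (basic (i , A , oA , W⊆ , ⊆W)) x∈W y = ⊆W (A-full i oA (W⊆ x∈W) (f i y))
initial-full 𝒯 f A-full (resp (V⊆W , W⊆V) oV) x∈W y = V⊆W (initial-full 𝒯 f A-full oV (W⊆V x∈W) y)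
initial-full 𝒯 f A-full whole x∈W y = _
initial-full 𝒯 f A-full (inter oV oW) (x∈V , x∈W) y =
  initial-full 𝒯 f A-full oV x∈V y , initial-full 𝒯 f A-full oW x∈W y
initial-full 𝒯 f A-full (union oV) (i , x∈V) y = i , initial-full 𝒯 f A-full (oV i) x∈V y

-- Periodicity of open sets along a determining monoid

module _ {𝒯 : Family} {M : Pred ℕ₁ 0ℓ} (det : IsDeterminingMonoid 𝒯 M) where
  open IsDeterminingMonoid det

  ContainsClass : ℕ₁ → ℤ → Pred ℤ 0ℓ → Set
  ContainsClass m z W = ∀ y → y ≡ z mod m → y ∈ W

  -- Induction on the generation of `W`. A subbasic set coming from `m ∈ M` supplies the modulus
  -- `m`, the whole space the modulus 1; at an intersection the two moduli are multiplied, which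
  -- stays inside `M`.
  restrict-open⇒class : ∀ {W} → Open (induced (restrict M 𝒯)) W →
                        z ∈ W → ∃[ m ] m ∈ M × ContainsClass m z W
  restrict-open⇒class (basic (m , A , inj₁ (m∈M , oA) , W⊆ , ⊆W)) z∈W =
    m , m∈M , λ y y≡z → ⊆W (subst (Sub._∈ A) (sym (mod⇒π≡ m y≡z)) (W⊆ z∈W))
  restrict-open⇒class (basic (m , A , inj₂ empty , W⊆ , ⊆W)) z∈W = contradiction (W⊆ z∈W) ∉⊥
  restrict-open⇒class (basic (m , A , inj₂ full , W⊆ , ⊆W)) z∈W = 1₁ , 1∈M , λ y _ → ⊆W ∈⊤
  restrict-open⇒class (resp (V⊆W , W⊆V) oV) z∈W =
    let m , m∈M , class = restrict-open⇒class oV (W⊆V z∈W)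
    in  m , m∈M , λ y → V⊆W ∘ class y
  restrict-open⇒class whole z∈W = 1₁ , 1∈M , _
  restrict-open⇒class {z = z} (inter oV oW) (z∈V , z∈W) =
    let m , m∈M , classV = restrict-open⇒class oV z∈V
        n , n∈M , classW = restrict-open⇒class oW z∈W
    in  m *₁ n , *-closed m∈M n∈M , λ y y≡z →
          classV y (mod-∣ (∣-*₁ˡ m n) y≡z) ,
          classW y (mod-∣ (∣-*₁ʳ m n) y≡z)
  restrict-open⇒class (union oV) (i , z∈V) =
    let m , m∈M , class = restrict-open⇒class (oV i) z∈V
    in  m , m∈M , λ y y≡z → i , class y y≡z

  -- Multiplies one witness per index; `mono` carries each property over to the product.
  common-multiple : (R : Fin k → Pred ℕ₁ ℓ) → (∀ i {m n} → m ∣₁ n → R i m → R i n) →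
                    (∀ i → ∃[ m ] m ∈ M × R i m) → ∃[ m ] m ∈ M × (∀ i → R i m)
  common-multiple {k = ℕ.zero} R mono ex = 1₁ , 1∈M , λ ()
  common-multiple {k = ℕ.suc k} R mono ex =
    let m , m∈M , r  = ex zero
        n , n∈M , rs = common-multiple (R ∘ suc) (mono ∘ suc) (ex ∘ suc)
    in  m *₁ n , *-closed m∈M n∈M , λ where
          zero    → mono zero (∣-*₁ˡ m n) r
          (suc i) → mono (suc i) (∣-*₁ʳ m n) (rs i)

  open⇒periodic : ∀ n A → OpenF (𝒯 n) A → ∃[ m ] m ∈ M ×
                  (∀ {y z} → y ≡ z mod m → π n z Sub.∈ A → π n y Sub.∈ A)
  open⇒periodic n A oA = proj₁ common , proj₁ (proj₂ common) , periodic
    where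
    O : Pred ℤ 0ℓ
    O = π n ⊢ (Sub._∈ A)

    oO : Open (induced (restrict M 𝒯)) O
    oO = Equivalence.to (determining O) (basic (n , A , oA , ≐-refl))

    -- Vacuous for residues outside `A`, so that every residue has a modulus, with 1 as the default.
    R : ℤ/ n → Pred ℕ₁ 0ℓ
    R a m = a Sub.∈ A → ContainsClass m (+ toℕ a) O

    modulus : ∀ a → ∃[ m ] m ∈ M × R a m
    modulus a with a ∈? A
    ... | no  a∉A = 1₁ , 1∈M , λ a∈A → contradiction a∈A a∉A
    ... | yes a∈A =
      let m , m∈M , class = restrict-open⇒class oO (subst (Sub._∈ A) (sym (π-toℕ n a)) a∈A)
      in  m , m∈M , λ _ → class

    common : ∃[ m ] m ∈ M × (∀ a → R a m)
    common = common-multiple R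
      (λ { a {m} {n} m∣n r a∈A y y≡a → r a∈A y (mod-∣ m∣n y≡a) }) modulus

    -- Translating by r − z, where r is the representative of z modulo n, moves y
    -- to a point congruent to y modulo n and to r modulo m.
    periodic : ∀ {y z} → y ≡ z mod proj₁ common → π n z Sub.∈ A → π n y Sub.∈ A
    periodic {y} {z} y≡z z∈O = subst (Sub._∈ A) (mod⇒π≡ n t≡y)
      (proj₂ (proj₂ common) (π n z) z∈O t t≡r)
      where
      r t : ℤ
      r = + toℕ (π n z)
      t = y + (r - z)

      t-y : ∀ y r z → r - z ≡ y + (r - z) - y
      t-y = solve-∀

      t-r : ∀ y r z → y - z ≡ y + (r - z) - r
      t-r = solve-∀

      t≡y : t ≡ y mod n
      t≡y = ∣-diff (subst (_ ∣_) (t-y y r z) (_≡_mod_.n∣y-z (toℕ-π-mod z n)))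

      t≡r : t ≡ r mod proj₁ common
      t≡r = ∣-diff (subst (_ ∣_) (t-r y r z) (_≡_mod_.n∣y-z y≡z))

  open-profiniteB⇒full : IsMaximal 𝒯 → ∀ x → x ∈ profiniteB 𝒯 M →
                         ∀ n {A} → OpenF (𝒯 n) A → π̂ n x Sub.∈ A → ∀ b → b Sub.∈ A
  open-profiniteB⇒full maximal (s , compatible) x∈B n {A} oA sₙ∈A b
    with m , m∈M , periodic ← open⇒periodic n A oA =
    -- The representative of `b` may be replaced by its remainder modulo `m`, whose class lies in
    -- the full set `Aₘ`.
    subst (Sub._∈ A) (π-toℕ n b)
      (periodic (mod-sym (toℕ-π-mod (+ toℕ b) m))
        (∈-preimage⁻ (image-full (π m (+ toℕ b)))))
    where
    -- The map `c ↦ π n (+ toℕ c)` depends on the chosen representatives, as `n` need not divide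
    -- `m`. By `periodic`, `Aₘ` and `A` still have the same preimage in the integers.
    Aₘ : Subset (value m)
    Aₘ = preimage (λ c → π n (+ toℕ c)) A

    oAₘ : OpenF (𝒯 m) Aₘ
    oAₘ = maximal⇒quotient 𝒯 maximal m (resp
      ((λ {z} z∈A → ∈-preimage⁺ (periodic (toℕ-π-mod z m) z∈A)) ,
       (λ {z} z∈ → periodic (mod-sym (toℕ-π-mod z m)) (∈-preimage⁻ z∈)))
      (basic (n , A , oA , ≐-refl)))

    -- One integer that agrees with `x` modulo both `m` and `n`, read off from the coordinate at
    -- their product.
    u : ℤ
    u = + toℕ (s (m *₁ n))

    πₙu≡sₙ : π n u ≡ s n
    πₙu≡sₙ = compatible n (m *₁ n) (∣-*₁ʳ m n)

    πₘu≡sₘ : π m u ≡ s m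
    πₘu≡sₘ = compatible m (m *₁ n) (∣-*₁ˡ m n)

    sₘ∈Aₘ : s m Sub.∈ Aₘ
    sₘ∈Aₘ = subst (Sub._∈ Aₘ) πₘu≡sₘ
      (∈-preimage⁺ (periodic (toℕ-π-mod u m) (subst (Sub._∈ A) (sym πₙu≡sₙ) sₙ∈A)))

    image-full : ∀ c → c Sub.∈ Aₘ
    image-full = open-closedCore⇒full (𝒯 m) (x∈B m m∈M) oAₘ sₘ∈Aₘ

proposition3p19 : ∀ (T : Topology ℤ) → IsPéijí T →
    ∀ (𝒯 : Family) → IsMaximalFamilyOf T 𝒯 →
    ∀ (M : Pred ℕ₁ 0ℓ) → IsDeterminingMonoid 𝒯 M →
    (∀ n m → n ∈ M → m ∈ M → (n∣m : n ∣₁ m) →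
    image (π↓ n m n∣m) (closedCore (𝒯 m)) ≐ closedCore (𝒯 n)) →
    ∀ (x : Ẑ) → x ∈ profiniteB 𝒯 M → IsIndiscretePoint (profinite 𝒯) x
proposition3p19 T _ 𝒯 (_ , maximal) M det _ x x∈B V (W , oW , V⊆W , W⊆V) x∈V =
  -- In the full product, `W` already contains every sequence, compatible or not.
  _ , λ {y} _ → W⊆V (initial-full 𝒯 (λ n s → s n)
    (open-profiniteB⇒full det maximal x x∈B) oW (V⊆W x∈V) (proj₁ y))
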